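{- For integers $1\le k\le N-1$, say that $(N,k)$ is optimal if $S_N(12\cdots k)>B^c_N(12\cdots k)$ (as rational numbers). Then: (i) if $(N,k)$ is optimal then $(N+1,k+1)$ is optimal; (ii) if $(N,k)$ is not optimal then $(N+1,k)$ is not optimal.
   Context: $\mathrm{Av}_N(321)$ is the set of permutations $\pi=\pi_1\cdots\pi_N$ of $[N]$ with no indices $a<b<c$ such that $\pi_a>\pi_b>\pi_c$. The $i$th prefix flattening $\pi|_{[i]}$ is the permutation of $[i]$ in the same relative order as $\pi_1,\dots,\pi_i$. $S_N(12\cdots k)$ is the probability that $\pi_k=N$ for $\pi$ uniformly random among $\pi\in\mathrm{Av}_N(321)$ with $\pi|_{[k]}=12\cdots k$. $B^c_N(12\cdots k)$ is the maximal winning probability in the following restricted game: $\pi$ is chosen uniformly at random among $\pi\in\mathrm{Av}_N(321)$ with $\pi|_{[k]}=12\cdots k$; candidates $1,\dots,k$ are rejected; for $i=k+1,\dots,N$ the player is shown $\pi|_{[i]}$ and, using only the prefix flattenings seen so far, accepts candidate $i$ (ending the game) or rejects it, candidate $N$ being accepted if all earlier ones are rejected; the player wins iff the accepted candidate $i$ has $\pi_i=N$. -}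

module Defs where

open import Data.Bool using (Bool; true; false; if_then_else_; _∧_; _∨_; not)
open import Data.Nat using (ℕ; zero; suc; _+_; _∸_; _≡ᵇ_; _<ᵇ_)
open import Data.List using (List; []; _∷_; _++_; [_]; map; concatMap; length; take; drop;
  filterᵇ; applyUpTo)
open import Data.Bool.ListAction using (any)
open import Data.Maybe using (Maybe; just; nothing)
open import Data.Integer using (+_)
open import Data.Rational using (ℚ; 0ℚ; _/_; _<_; _≤_)
open import Data.Product using (Σ; _×_; ∃)
open import Relation.Binary.PropositionalEquality using (_≡_)

-- Permutations of [N] = {1,…,N}, in one-line notation π₁ ⋯ π_N (lists).

insertions : ℕ → List ℕ → List (List ℕ)
insertions x []       = (x ∷ []) ∷ []
insertions x (y ∷ ys) = (x ∷ y ∷ ys) ∷ map (y ∷_) (insertions x ys)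

perms : ℕ → List (List ℕ)
perms zero    = [] ∷ []
perms (suc n) = concatMap (insertions (suc n)) (perms n)

-- 1-based indexing: at π i = just π_i
at : List ℕ → ℕ → Maybe ℕ
at []       _             = nothing
at (x ∷ xs) zero          = nothing
at (x ∷ xs) (suc zero)    = just x
at (x ∷ xs) (suc (suc i)) = at xs (suc i)

has21below : ℕ → List ℕ → Bool
has21below x []       = false
has21below x (y ∷ ys) = ((y <ᵇ x) ∧ any (λ z → z <ᵇ y) ys) ∨ has21below x ys

contains321 : List ℕ → Bool
contains321 []       = false
contains321 (x ∷ xs) = has21below x xs ∨ contains321 xs

Avoids321 : List ℕ → Bool
Avoids321 π = not (contains321 π)

-- Flattening: the permutation of [i] in the same relative order as xs
-- (each entry x replaced by 1 + #{entries of xs smaller than x}).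

flatten : List ℕ → List ℕ
flatten xs = map (λ x → suc (length (filterᵇ (λ y → y <ᵇ x) xs))) xs

prefixFlat : List ℕ → ℕ → List ℕ
prefixFlat π i = flatten (take i π)

idPerm : ℕ → List ℕ
idPerm k = applyUpTo suc k

listEqᵇ : List ℕ → List ℕ → Bool
listEqᵇ []       []       = true
listEqᵇ []       (_ ∷ _)  = false
listEqᵇ (_ ∷ _)  []       = false
listEqᵇ (x ∷ xs) (y ∷ ys) = (x ≡ᵇ y) ∧ listEqᵇ xs ys

maybeEqᵇ : Maybe ℕ → ℕ → Bool
maybeEqᵇ (just x) y = x ≡ᵇ y
maybeEqᵇ nothing  y = false

Space : ℕ → ℕ → List (List ℕ)
Space N k = filterᵇ (λ π → Avoids321 π ∧ listEqᵇ (prefixFlat π k) (idPerm k)) (perms N)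

-- probability of a boolean event under the uniform distribution on a
-- finite list (the list is never empty in our uses; 0 otherwise)
prob : (List ℕ → Bool) → List (List ℕ) → ℚ
prob E xs with length xs
... | zero  = 0ℚ
... | suc m = (+ length (filterᵇ E xs)) / suc m

S : ℕ → ℕ → ℚ
S N k = prob (λ π → maybeEqᵇ (at π k) N) (Space N k)

-- The restricted game.  A strategy sees the history of prefix flattenings
-- π|_[k+1], …, π|_[i] (oldest first) and decides to accept (true) or
-- reject (false) candidate i.

Strategy : Set
Strategy = List (List ℕ) → Bool

-- index of the accepted candidate; the remaining candidates are listed;
-- the last candidate (N) is accepted if all earlier ones were rejected.
play : Strategy → List ℕ → List (List ℕ) → List ℕ → ℕ
play s π hist []             = zero
play s π hist (i ∷ [])       = i
play s π hist (i ∷ j ∷ is)   =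
  let h = hist ++ [ prefixFlat π i ] in
  if s h then i else play s π h (j ∷ is)

candidates : ℕ → ℕ → List ℕ
candidates N k = applyUpTo (λ j → suc (k + j)) (N ∸ k)

accepted : ℕ → ℕ → Strategy → List ℕ → ℕ
accepted N k s π = play s π [] (candidates N k)

winProb : ℕ → ℕ → Strategy → ℚ
winProb N k s = prob (λ π → maybeEqᵇ (at π (accepted N k s π)) N) (Space N k)

IsBc : ℕ → ℕ → ℚ → Set
IsBc N k q = (∃ λ s → winProb N k s ≡ q) × (∀ s → winProb N k s ≤ q)

Optimal : ℕ → ℕ → Set
Optimal N k = ∃ λ q → IsBc N k q × (q < S N k)

{-# OPTIONS --safe #-}
module Submission where

-- Write i for the length of a 321-avoiding prefix and j for the number of its values above the
-- largest entry that plays the role of 1 in a pattern 21. The next entry must be placed above all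
-- such entries: if it has t ≥ 1 larger values above it, the new state is t, with 1 ≤ t ≤ j, and if
-- it is a new maximum, the new state is j + 1. So with n candidates to come, everything depends on
-- j and n only: wins n j extensions keep the current maximum maximal, and the best strategy
-- rejecting everything so far wins on value n j extensions, where
--   wins  (n + 1) j = Σ_{t ≤ j} wins n t,
--   value (n + 1) j = Σ_{t ≤ j} value n t + max (wins n (j + 1)) (value n (j + 1)).
-- Hence (n + k, k) is optimal iff value n k < wins n k. The ratio value n j / wins n j is
-- decreasing in j, by induction on n: averages of a decreasing ratio decrease, and
-- wins n (j + 1) / wins (n + 1) j = (n + 1) / j decreases. This gives (i); and (ii) follows by
-- summation, because non-optimality of j is inherited by all t ≤ j.

open import Defs
open import Algebra using (CommutativeMonoid; CommutativeSemigroup)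
open import Algebra.Properties.CommutativeSemigroup using (interchange)
open import Data.Bool using (Bool; true; false; if_then_else_; _∧_; _∨_; not; T)
open import Data.Bool.ListAction using (any)
open import Data.Bool.Properties using (∨-identityʳ; ∨-zeroʳ; ∨-assoc; ∨-commutativeMonoid;
  ∧-identityʳ; ∧-zeroʳ; ∧-assoc; ∧-distribˡ-∨; if-float)
open import Data.Integer as ℤ using (+≤+; +<+)
import Data.Integer.Properties as ℤ
open import Data.List using (List; []; _∷_; [_]; _∷ʳ_; _++_; map; concatMap; length; take; filterᵇ;
  applyUpTo; upTo; foldl)
open import Data.List.Properties using (map-cong; map-∘; map-++; map-id-local; length-map; take-map;
  take-all; applyUpTo-∷ʳ; map-applyUpTo; upTo-∷ʳ; foldl-∷ʳ)
open import Data.List.Relation.Unary.All as All using (All; []; _∷_)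
open import Data.List.Relation.Unary.All.Properties using (++⁺; map⁺)
open import Data.Maybe using (just; nothing)
open import Data.Nat using (ℕ; zero; suc; _+_; _*_; _∸_; _⊔_; _≤_; _<_; z≤n; s≤s; s≤s⁻¹; _≤?_;
  _<ᵇ_; _≤ᵇ_; _≡ᵇ_; NonZero; >-nonZero)
open import Data.Nat.ListAction using (sum)
open import Data.Nat.ListAction.Properties using (sum-++)
open import Data.Nat.Properties
open import Data.Nat.Tactic.RingSolver using (solve-∀)
open import Data.Product using (_×_; _,_; proj₁; proj₂)
open import Data.Rational as ℚ using (_/_)
import Data.Rational.Properties as ℚ
open import Data.Rational.Unnormalised using (mkℚᵘ; *≤*; *<*)
import Data.Rational.Unnormalised.Properties as ℚᵘ
open import Function using (_∘_; id; _⇔_; mk⇔; Equivalence)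
open import Relation.Binary.PropositionalEquality hiding ([_])
open import Relation.Nullary using (¬_; yes; no)

-- The recursion for wins and value

sumTo : (ℕ → ℕ) → ℕ → ℕ
sumTo h zero    = 0
sumTo h (suc j) = h (suc j) + sumTo h j

sumTo-cong : ∀ {g h} j → (∀ t → 1 ≤ t → t ≤ j → g t ≡ h t) → sumTo g j ≡ sumTo h j
sumTo-cong zero    eq = refl
sumTo-cong (suc j) eq =
  cong₂ _+_ (eq (suc j) (s≤s z≤n) ≤-refl) (sumTo-cong j λ t 1≤t t≤j → eq t 1≤t (m≤n⇒m≤1+n t≤j))

sumTo-mono : ∀ {g h} j → (∀ t → 1 ≤ t → t ≤ j → g t ≤ h t) → sumTo g j ≤ sumTo h j
sumTo-mono zero    le = z≤n
sumTo-mono (suc j) le =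
  +-mono-≤ (le (suc j) (s≤s z≤n) ≤-refl) (sumTo-mono j λ t 1≤t t≤j → le t 1≤t (m≤n⇒m≤1+n t≤j))

sumTo-0 : ∀ j → sumTo (λ _ → 0) j ≡ 0
sumTo-0 zero    = refl
sumTo-0 (suc j) = sumTo-0 j

-- This is the binomial coefficient C(n + j - 1, n); the recursion is the hockey-stick identity.
wins : ℕ → ℕ → ℕ
wins zero    j = 1
wins (suc n) j = sumTo (wins n) j

value : ℕ → ℕ → ℕ
-- A player who has rejected every candidate wins nothing. At the last candidate the maximum is
-- therefore 1 ⊔ 0, in accordance with its forced acceptance.
value zero    j = 0
value (suc n) j = sumTo (value n) j + (wins n (suc j) ⊔ value n (suc j))

wins>0 : ∀ n j → 0 < wins n (suc j)
wins>0 zero    j = s≤s z≤n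
wins>0 (suc n) j = ≤-trans (wins>0 n j) (m≤m+n _ _)

-- The absorption identity for binomial coefficients, by induction along Pascal's rule.
wins-absorption : ∀ n j → j * wins n (suc j) ≡ suc n * wins (suc n) j
wins-absorption zero    zero    = refl
wins-absorption zero    (suc j) = cong suc (wins-absorption zero j)
wins-absorption (suc n) zero    = sym (*-zeroʳ n)
wins-absorption (suc n) (suc j) = begin
  suc j * (wins n (2 + j) + x)              ≡⟨ *-distribˡ-+ (suc j) (wins n (2 + j)) x ⟩
  suc j * wins n (2 + j) + suc j * x        ≡⟨ cong (_+ suc j * x) (wins-absorption n (suc j)) ⟩
  suc n * x + suc j * x                     ≡⟨ lemma n j x ⟩
  (2 + n) * x + j * x                       ≡⟨ cong ((2 + n) * x +_) (wins-absorption (suc n) j) ⟩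
  (2 + n) * x + (2 + n) * wins (2 + n) j    ≡⟨ *-distribˡ-+ (2 + n) x (wins (2 + n) j) ⟨
  (2 + n) * (x + wins (2 + n) j)            ∎
  where
  open ≡-Reasoning
  x : ℕ
  x = wins (suc n) (suc j)
  lemma : ∀ n j x → suc n * x + suc j * x ≡ (2 + n) * x + j * x
  lemma = solve-∀

-- Scaled by (n + 1)(j + 1), both sides become multiples of (n + 1) w₁ b₁ by absorption, with
-- factors j and j + 1.
wins-logConcave : ∀ n j →
  wins n (2 + j) * wins (suc n) j ≤ wins n (suc j) * wins (suc n) (suc j)
wins-logConcave n j = *-cancelˡ-≤ (suc n * suc j) (begin
  suc n * suc j * (w₂ * b₀)         ≡⟨ rearrange₁ n j w₂ b₀ ⟩
  suc j * w₂ * (suc n * b₀)         ≡⟨ cong₂ _*_ (wins-absorption n (suc j)) (sym (wins-absorption n j)) ⟩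
  suc n * b₁ * (j * w₁)             ≡⟨ rearrange₂ n j w₁ b₁ ⟩
  suc n * j * (w₁ * b₁)             ≤⟨ *-monoˡ-≤ (w₁ * b₁) (*-monoʳ-≤ (suc n) (n≤1+n j)) ⟩
  suc n * suc j * (w₁ * b₁)         ∎)
  where
  open ≤-Reasoning
  w₁ w₂ b₀ b₁ : ℕ
  w₁ = wins n (suc j)
  w₂ = wins n (2 + j)
  b₀ = wins (suc n) j
  b₁ = wins (suc n) (suc j)
  rearrange₁ : ∀ n j w b → suc n * suc j * (w * b) ≡ suc j * w * (suc n * b)
  rearrange₁ = solve-∀
  rearrange₂ : ∀ n j w b → suc n * b * (j * w) ≡ suc n * j * (w * b)
  rearrange₂ = solve-∀

-- Transitivity of the ratio order a/b ≤ c/d, which needs a positive middle denominator.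
ratio-trans : ∀ {a b c d e f} → 0 < d → a * d ≤ c * b → c * f ≤ e * d → a * f ≤ e * b
ratio-trans {a} {b} {c} {d} {e} {f} 0<d ad≤cb cf≤ed = *-cancelʳ-≤ _ _ d (begin
  a * f * d   ≡⟨ swap a f d ⟩
  a * d * f   ≤⟨ *-monoˡ-≤ f ad≤cb ⟩
  c * b * f   ≡⟨ swap c b f ⟩
  c * f * b   ≤⟨ *-monoˡ-≤ b cf≤ed ⟩
  e * d * b   ≡⟨ swap e d b ⟩
  e * b * d   ∎)
  where
  open ≤-Reasoning
  instance
    d≢0 : NonZero d
    d≢0 = >-nonZero 0<d
  swap : ∀ x y z → x * y * z ≡ x * z * y
  swap = solve-∀

-- Cross-multiplied, because `wins n 0` vanishes for positive n.
RatioAntitone : (ℕ → ℕ) → (ℕ → ℕ) → Set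
RatioAntitone v w = ∀ j → v (suc j) * w j ≤ v j * w (suc j)

module _ {v w : ℕ → ℕ} (w>0 : ∀ j → 0 < w (suc j)) (v/w : RatioAntitone v w) where

  -- The ratio at j + 1 is at most every earlier one, hence at most the mediant of those at 1, ...,
  -- j.
  sumTo-ratio : ∀ j → v (suc j) * sumTo w j ≤ sumTo v j * w (suc j)
  sumTo-ratio zero    = ≤-reflexive (*-zeroʳ (v 1))
  sumTo-ratio (suc j) = begin
    v (2 + j) * (w (suc j) + sumTo w j)                        ≡⟨ *-distribˡ-+ (v (2 + j)) _ _ ⟩
    v (2 + j) * w (suc j) + v (2 + j) * sumTo w j              ≤⟨ +-mono-≤ (v/w (suc j))
      (ratio-trans {v (2 + j)} {w (2 + j)} {v (suc j)} {w (suc j)} {sumTo v j} (w>0 j) (v/w (suc j)) (sumTo-ratio j)) ⟩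
    v (suc j) * w (2 + j) + sumTo v j * w (2 + j)              ≡⟨ *-distribʳ-+ (w (2 + j)) (v (suc j)) _ ⟨
    (v (suc j) + sumTo v j) * w (2 + j)                        ∎
    where open ≤-Reasoning

  -- A further term whose ratio is at most the current mediant cannot raise that mediant.
  sumTo-ratioAntitone : RatioAntitone (sumTo v) (sumTo w)
  sumTo-ratioAntitone j = begin
    (v (suc j) + sumTo v j) * sumTo w j                ≡⟨ *-distribʳ-+ (sumTo w j) (v (suc j)) _ ⟩
    v (suc j) * sumTo w j + sumTo v j * sumTo w j      ≤⟨ +-monoˡ-≤ (sumTo v j * sumTo w j) (sumTo-ratio j) ⟩
    sumTo v j * w (suc j) + sumTo v j * sumTo w j      ≡⟨ *-distribˡ-+ (sumTo v j) _ _ ⟨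
    sumTo v j * (w (suc j) + sumTo w j)                ∎
    where open ≤-Reasoning

-- The two summands of `value (suc n) j` are compared with `wins (suc n) j` separately: the sum by
-- averaging, the maximum through each of its two arguments.
value/wins-antitone : ∀ n → RatioAntitone (value n) (wins n)
value/wins-antitone zero    j = z≤n
value/wins-antitone (suc n) j = begin
  (sumTo v (suc j) + m₂) * b₀       ≡⟨ *-distribʳ-+ b₀ (sumTo v (suc j)) m₂ ⟩
  sumTo v (suc j) * b₀ + m₂ * b₀    ≤⟨ +-mono-≤ (sumTo-ratioAntitone (wins>0 n) IH j) max-ratio ⟩
  sumTo v j * b₁ + m₁ * b₁          ≡⟨ *-distribʳ-+ b₁ (sumTo v j) m₁ ⟨
  (sumTo v j + m₁) * b₁             ∎
  where
  open ≤-Reasoning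
  v w : ℕ → ℕ
  v = value n
  w = wins n
  m₁ m₂ b₀ b₁ : ℕ
  m₁ = w (suc j) ⊔ v (suc j)
  m₂ = w (2 + j) ⊔ v (2 + j)
  b₀ = wins (suc n) j
  b₁ = wins (suc n) (suc j)
  IH : RatioAntitone v w
  IH = value/wins-antitone n
  logConcave : w (2 + j) * b₀ ≤ w (suc j) * b₁
  logConcave = wins-logConcave n j
  -- Ratios of neighbours are chained: v (j + 2) / v (j + 1) ≤ w (j + 2) / w (j + 1) ≤ b₁ / b₀. The
  -- middle denominator w (j + 1) is positive, while v (j + 1) and b₀ can be 0.
  value-ratio : v (2 + j) * b₀ ≤ v (suc j) * b₁
  value-ratio = subst (v (2 + j) * b₀ ≤_) (*-comm b₁ (v (suc j)))
    (ratio-trans {v (2 + j)} {v (suc j)} {w (2 + j)} {w (suc j)} {b₁} {b₀} (wins>0 n j)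
      (≤-trans (IH (suc j)) (≤-reflexive (*-comm (v (suc j)) (w (2 + j)))))
      (≤-trans logConcave (≤-reflexive (*-comm (w (suc j)) b₁))))
  max-ratio : m₂ * b₀ ≤ m₁ * b₁
  max-ratio = begin
    m₂ * b₀                           ≡⟨ *-distribʳ-⊔ b₀ (w (2 + j)) (v (2 + j)) ⟩
    w (2 + j) * b₀ ⊔ v (2 + j) * b₀   ≤⟨ ⊔-mono-≤ logConcave value-ratio ⟩
    w (suc j) * b₁ ⊔ v (suc j) * b₁   ≡⟨ *-distribʳ-⊔ b₁ (w (suc j)) (v (suc j)) ⟨
    m₁ * b₁                           ∎

-- Part (i) in terms of counts: with n fixed, a ratio below 1 stays below 1 as j grows.
value<wins-suc : ∀ n j → value n (suc j) < wins n (suc j) → value n (2 + j) < wins n (2 + j)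
value<wins-suc n j v<w = *-cancelʳ-< (wins n (suc j)) _ _ (begin-strict
  value n (2 + j) * wins n (suc j)   ≤⟨ value/wins-antitone n (suc j) ⟩
  value n (suc j) * wins n (2 + j)   <⟨ *-monoˡ-< (wins n (2 + j)) ⦃ >-nonZero (wins>0 n (suc j)) ⦄ v<w ⟩
  wins n (suc j) * wins n (2 + j)    ≡⟨ *-comm (wins n (suc j)) _ ⟩
  wins n (2 + j) * wins n (suc j)    ∎)
  where open ≤-Reasoning

-- By the contrapositive of `value<wins-suc` the hypothesis descends from j + 1 to every t ≥ 1, so
-- it can be summed termwise.
sumTo-wins≤value : ∀ n j → wins n (suc j) ≤ value n (suc j) →
  sumTo (wins n) (suc j) ≤ sumTo (value n) (suc j)
sumTo-wins≤value n zero    w≤v = +-monoˡ-≤ 0 w≤v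
sumTo-wins≤value n (suc j) w≤v =
  +-mono-≤ w≤v (sumTo-wins≤value n j (≮⇒≥ λ v<w → <⇒≱ (value<wins-suc n j v<w) w≤v))

-- Part (ii), contraposed: the reverse inequality at n survives summation, and the maximum in the
-- recursion only adds to `value (suc n)`.
value<wins-pred : ∀ n j → value (suc n) (suc j) < wins (suc n) (suc j) →
  value n (suc j) < wins n (suc j)
value<wins-pred n j v<w = ≰⇒> λ w≤v →
  <⇒≱ v<w (≤-trans (sumTo-wins≤value n j w≤v) (m≤m+n _ _))

-- Permutations grown by their last entry

private variable
  A B : Set

<ᵇ-true : ∀ {m n} → m < n → (m <ᵇ n) ≡ true
<ᵇ-true {zero}  (s≤s _)         = refl
<ᵇ-true {suc m} (s≤s m<n@(s≤s _)) = <ᵇ-true {m} m<n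

<ᵇ-false : ∀ {m n} → n ≤ m → (m <ᵇ n) ≡ false
<ᵇ-false z≤n       = refl
<ᵇ-false (s≤s n≤m) = <ᵇ-false n≤m

≡ᵇ-refl : ∀ n → (n ≡ᵇ n) ≡ true
≡ᵇ-refl zero    = refl
≡ᵇ-refl (suc n) = ≡ᵇ-refl n

<⇒≡ᵇ-false : ∀ {m n} → m < n → (m ≡ᵇ n) ≡ false
<⇒≡ᵇ-false {zero}  (s≤s _)           = refl
<⇒≡ᵇ-false {suc m} (s≤s m<n@(s≤s _)) = <⇒≡ᵇ-false m<n

<ᵇ-⊔ : ∀ z a b → (z <ᵇ a ⊔ b) ≡ (z <ᵇ a) ∨ (z <ᵇ b)
<ᵇ-⊔ z       zero    b       = refl
<ᵇ-⊔ z       (suc a) zero    = sym (∨-identityʳ _)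
<ᵇ-⊔ zero    (suc a) (suc b) = refl
<ᵇ-⊔ (suc z) (suc a) (suc b) = <ᵇ-⊔ z a b

-- Finite sums over lists

∑ : List A → (A → ℕ) → ℕ
∑ xs f = sum (map f xs)

∑-cong : ∀ {f g : A → ℕ} (xs : List A) → (∀ x → f x ≡ g x) → ∑ xs f ≡ ∑ xs g
∑-cong xs f≗g = cong sum (map-cong f≗g xs)

∑-++ : ∀ (xs ys : List A) f → ∑ (xs ++ ys) f ≡ ∑ xs f + ∑ ys f
∑-++ xs ys f = trans (cong sum (map-++ f xs ys)) (sum-++ (map f xs) (map f ys))

∑-∷ʳ : ∀ (xs : List A) x f → ∑ (xs ∷ʳ x) f ≡ ∑ xs f + f x
∑-∷ʳ xs x f = trans (∑-++ xs [ x ] f) (cong (∑ xs f +_) (+-identityʳ (f x)))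

∑-map : ∀ (g : B → A) xs f → ∑ (map g xs) f ≡ ∑ xs (f ∘ g)
∑-map g xs f = cong sum (sym (map-∘ xs))

∑-concatMap : ∀ (g : B → List A) xs f → ∑ (concatMap g xs) f ≡ ∑ xs (λ x → ∑ (g x) f)
∑-concatMap g []       f = refl
∑-concatMap g (x ∷ xs) f =
  trans (∑-++ (g x) (concatMap g xs) f) (cong (∑ (g x) f +_) (∑-concatMap g xs f))

∑-0 : ∀ (xs : List A) → ∑ xs (λ _ → 0) ≡ 0
∑-0 []       = refl
∑-0 (x ∷ xs) = ∑-0 xs

∑-+ : ∀ (xs : List A) f g → ∑ xs (λ x → f x + g x) ≡ ∑ xs f + ∑ xs g
∑-+ []       f g = refl
∑-+ (x ∷ xs) f g =
  trans (cong (f x + g x +_) (∑-+ xs f g)) (interchange +-commutativeSemigroup (f x) (g x) (∑ xs f) (∑ xs g))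

∑-comm : ∀ (xs : List A) (ys : List B) (f : A → B → ℕ) →
  ∑ xs (λ x → ∑ ys (f x)) ≡ ∑ ys (λ y → ∑ xs (λ x → f x y))
∑-comm []       ys f = sym (∑-0 ys)
∑-comm (x ∷ xs) ys f =
  trans (cong (∑ ys (f x) +_) (∑-comm xs ys f)) (sym (∑-+ ys (f x) (λ y → ∑ xs (λ x → f x y))))

∑-filterᵇ : ∀ (χ : A → Bool) xs f → ∑ (filterᵇ χ xs) f ≡ ∑ xs (λ x → if χ x then f x else 0)
∑-filterᵇ χ []       f = refl
∑-filterᵇ χ (x ∷ xs) f with χ x
... | true  = cong (f x +_) (∑-filterᵇ χ xs f)
... | false = ∑-filterᵇ χ xs f

indicator : Bool → ℕ
indicator b = if b then 1 else 0

length-filterᵇ : ∀ (χ : A → Bool) xs → length (filterᵇ χ xs) ≡ ∑ xs (indicator ∘ χ)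
length-filterᵇ χ []       = refl
length-filterᵇ χ (x ∷ xs) with χ x
... | true  = cong suc (length-filterᵇ χ xs)
... | false = length-filterᵇ χ xs

∑-upTo-first : ∀ n f → ∑ (upTo (suc n)) f ≡ f 0 + ∑ (upTo n) (f ∘ suc)
∑-upTo-first n f = cong (λ xs → f 0 + sum xs)
  (trans (map-applyUpTo suc f n) (sym (map-applyUpTo id (f ∘ suc) n)))

∑-upTo-last : ∀ n f → ∑ (upTo (suc n)) f ≡ ∑ (upTo n) f + f n
∑-upTo-last n f = trans (cong (λ xs → ∑ xs f) (sym (upTo-∷ʳ n))) (∑-∷ʳ (upTo n) n f)

∑-upTo-cong : ∀ n {f g : ℕ → ℕ} → (∀ s → s < n → f s ≡ g s) → ∑ (upTo n) f ≡ ∑ (upTo n) g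
∑-upTo-cong zero    f≗g = refl
∑-upTo-cong (suc n) {f} {g} f≗g = trans (∑-upTo-last n f) (trans
  (cong₂ _+_ (∑-upTo-cong n λ s s<n → f≗g s (m≤n⇒m≤1+n s<n)) (f≗g n ≤-refl))
  (sym (∑-upTo-last n g)))

-- The relabelling that makes room for the value suc s.
bump : ℕ → ℕ → ℕ
bump _       zero    = zero
bump zero    (suc y) = suc (suc y)
bump (suc s) (suc y) = suc (bump s y)

bump-≤ : ∀ {s y} → y ≤ s → bump s y ≡ y
bump-≤ z≤n       = refl
bump-≤ (s≤s y≤s) = cong suc (bump-≤ y≤s)

bump-> : ∀ {s y} → s < y → bump s y ≡ suc y
bump-> {zero}  (s≤s _)           = refl
bump-> {suc s} (s≤s s<y) = cong suc (bump-> s<y)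

bump-inflates : ∀ s y → y ≤ bump s y
bump-inflates s       zero    = z≤n
bump-inflates zero    (suc y) = n≤1+n _
bump-inflates (suc s) (suc y) = s≤s (bump-inflates s y)

bump-bound : ∀ s {y n} → y ≤ n → bump s y ≤ suc n
bump-bound s       {zero}  y≤n       = z≤n
bump-bound zero    {suc y} y≤n       = s≤s y≤n
bump-bound (suc s) {suc y} (s≤s y≤n) = s≤s (bump-bound s y≤n)

bump-<ᵇ : ∀ s x y → (bump s x <ᵇ bump s y) ≡ (x <ᵇ y)
bump-<ᵇ s       x       zero    = refl
bump-<ᵇ zero    zero    (suc y) = refl
bump-<ᵇ zero    (suc x) (suc y) = refl
bump-<ᵇ (suc s) zero    (suc y) = refl
bump-<ᵇ (suc s) (suc x) (suc y) = bump-<ᵇ s x y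

bump-⊔ : ∀ s x y → bump s (x ⊔ y) ≡ bump s x ⊔ bump s y
bump-⊔ s       zero    y       = refl
bump-⊔ zero    (suc x) zero    = refl
bump-⊔ (suc s) (suc x) zero    = refl
bump-⊔ zero    (suc x) (suc y) = refl
bump-⊔ (suc s) (suc x) (suc y) = cong suc (bump-⊔ s x y)

bump<ᵇ-low : ∀ {s t} y → t ≤ s → (bump s y <ᵇ suc t) ≡ (y <ᵇ suc t)
bump<ᵇ-low               zero    t≤s       = refl
bump<ᵇ-low {zero}        (suc y) z≤n       = refl
bump<ᵇ-low {suc s} {zero} (suc y) z≤n      = refl
bump<ᵇ-low {suc s} {suc t} (suc y) (s≤s t≤s) = bump<ᵇ-low y t≤s

bump<ᵇ-high : ∀ {s t} y → s ≤ t → (bump s y <ᵇ suc (suc t)) ≡ (y <ᵇ suc t)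
bump<ᵇ-high                 zero    s≤t       = refl
bump<ᵇ-high {zero}          (suc y) z≤n       = refl
bump<ᵇ-high {suc s} {suc t} (suc y) (s≤s s≤t) = bump<ᵇ-high y s≤t

<ᵇbump-high : ∀ {s t} y → s ≤ t → (suc t <ᵇ bump s y) ≡ (t <ᵇ y)
<ᵇbump-high                 zero    s≤t       = refl
<ᵇbump-high {zero}          (suc y) z≤n       = refl
<ᵇbump-high {suc s} {suc t} (suc y) (s≤s s≤t) = <ᵇbump-high y s≤t

-- The parameter `s` is the number of old values below the new last entry, so a permutation of [i]
-- has the extensions s = 0, ..., i.
append : ℕ → List ℕ → List ℕ
append s p = map (bump s) p ∷ʳ suc s

data Perm : ℕ → List ℕ → Set where
  []   : Perm 0 []
  snoc : ∀ {i s p} → s ≤ i → Perm i p → Perm (suc i) (append s p)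

length-∷ʳ : ∀ (xs : List A) x → length (xs ∷ʳ x) ≡ suc (length xs)
length-∷ʳ []       x = refl
length-∷ʳ (_ ∷ xs) x = cong suc (length-∷ʳ xs x)

length-append : ∀ s p → length (append s p) ≡ suc (length p)
length-append s p = trans (length-∷ʳ (map (bump s) p) (suc s)) (cong suc (length-map (bump s) p))

length-perm : ∀ {i p} → Perm i p → length p ≡ i
length-perm []               = refl
length-perm (snoc {s = s} {p} _ P) = trans (length-append s p) (cong suc (length-perm P))

perm-bounded : ∀ {i p} → Perm i p → All (λ x → 1 ≤ x × x ≤ i) p
perm-bounded []                   = []
perm-bounded (snoc {s = s} s≤i P) = ++⁺
  (map⁺ (All.map (λ {x} (1≤x , x≤i) → ≤-trans 1≤x (bump-inflates s x) , bump-bound s x≤i) (perm-bounded P)))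
  ((s≤s z≤n , s≤s s≤i) ∷ [])

append-top : ∀ {i p} → Perm i p → append i p ≡ p ∷ʳ suc i
append-top {i} P = cong (_∷ʳ suc i) (map-id-local (All.map (bump-≤ ∘ proj₂) (perm-bounded P)))

-- Growth at the end keeps all earlier prefix flattenings, whereas `perms` inserts the maximum
-- anywhere and disturbs them.
permSum : ℕ → (List ℕ → ℕ) → ℕ
permSum zero    f = f []
permSum (suc n) f = permSum n (λ p → ∑ (upTo (suc n)) (λ s → f (append s p)))

permSum-cong : ∀ n {f g} → (∀ {p} → Perm n p → f p ≡ g p) → permSum n f ≡ permSum n g
permSum-cong zero    f≗g = f≗g []
permSum-cong (suc n) f≗g =
  permSum-cong n λ P → ∑-upTo-cong (suc n) λ s s<1+n → f≗g (snoc (s≤s⁻¹ s<1+n) P)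

permSum-+ : ∀ n f g → permSum n (λ p → f p + g p) ≡ permSum n f + permSum n g
permSum-+ zero    f g = refl
permSum-+ (suc n) f g = trans
  (permSum-cong n λ {p} _ → ∑-+ (upTo (suc n)) (λ s → f (append s p)) (λ s → g (append s p)))
  (permSum-+ n (λ p → ∑ (upTo (suc n)) (λ s → f (append s p))) (λ p → ∑ (upTo (suc n)) (λ s → g (append s p))))

-- Inserting the maximum versus appending a last entry

insertions-map : ∀ (g : ℕ → ℕ) x xs → insertions (g x) (map g xs) ≡ map (map g) (insertions x xs)
insertions-map g x []       = refl
insertions-map g x (y ∷ ys) = cong ((g x ∷ g y ∷ map g ys) ∷_) (begin
  map (g y ∷_) (insertions (g x) (map g ys))   ≡⟨ cong (map (g y ∷_)) (insertions-map g x ys) ⟩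
  map (g y ∷_) (map (map g) (insertions x ys)) ≡⟨ map-∘ (insertions x ys) ⟨
  map (map g ∘ (y ∷_)) (insertions x ys)       ≡⟨ map-∘ (insertions x ys) ⟩
  map (map g) (map (y ∷_) (insertions x ys))   ∎)
  where open ≡-Reasoning

insertions-∷ʳ : ∀ x xs z →
  insertions x (xs ∷ʳ z) ≡ map (_∷ʳ z) (insertions x xs) ∷ʳ (xs ∷ʳ z ∷ʳ x)
insertions-∷ʳ x []       z = refl
insertions-∷ʳ x (y ∷ ys) z = cong ((x ∷ y ∷ ys ∷ʳ z) ∷_) (begin
  map (y ∷_) (insertions x (ys ∷ʳ z))                                    ≡⟨ cong (map (y ∷_)) (insertions-∷ʳ x ys z) ⟩
  map (y ∷_) (map (_∷ʳ z) is ∷ʳ (ys ∷ʳ z ∷ʳ x))                          ≡⟨ map-++ (y ∷_) (map (_∷ʳ z) is) _ ⟩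
  map (y ∷_) (map (_∷ʳ z) is) ∷ʳ (y ∷ ys ∷ʳ z ∷ʳ x)                      ≡⟨ cong (_∷ʳ (y ∷ ys ∷ʳ z ∷ʳ x)) (trans (sym (map-∘ is)) (map-∘ is)) ⟩
  map (_∷ʳ z) (map (y ∷_) is) ∷ʳ (y ∷ ys ∷ʳ z ∷ʳ x)                      ∎)
  where
  open ≡-Reasoning
  is : List (List ℕ)
  is = insertions x ys

-- As s ≤ n, the maximum n + 2 is `bump s` of n + 1. Inserting it before the last entry thus amounts
-- to inserting n + 1 into `q` and appending afterwards; only the insertion at the very end remains.
insertions-append : ∀ {n s} q → s ≤ n →
  insertions (suc (suc n)) (append s q) ≡
  map (append s) (insertions (suc n) q) ∷ʳ (append s q ∷ʳ suc (suc n))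
insertions-append {n} {s} q s≤n = begin
  insertions (2 + n) (append s q)
    ≡⟨ insertions-∷ʳ (2 + n) (map (bump s) q) (suc s) ⟩
  map (_∷ʳ suc s) (insertions (2 + n) (map (bump s) q)) ∷ʳ new
    ≡⟨ cong (λ x → map (_∷ʳ suc s) (insertions x (map (bump s) q)) ∷ʳ new) (bump-> (s≤s s≤n)) ⟨
  map (_∷ʳ suc s) (insertions (bump s (suc n)) (map (bump s) q)) ∷ʳ new
    ≡⟨ cong (λ x → map (_∷ʳ suc s) x ∷ʳ new) (insertions-map (bump s) (suc n) q) ⟩
  map (_∷ʳ suc s) (map (map (bump s)) (insertions (suc n) q)) ∷ʳ new
    ≡⟨ cong (_∷ʳ new) (map-∘ (insertions (suc n) q)) ⟨
  map (append s) (insertions (suc n) q) ∷ʳ new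
    ∎
  where
  open ≡-Reasoning
  new : List ℕ
  new = append s q ∷ʳ suc (suc n)

-- Inserting the new maximum anywhere but at the end commutes with appending a last entry, so
-- the two ways of growing a permutation produce the same sums.
∑-perms : ∀ n f → ∑ (perms n) f ≡ permSum n f
∑-perms zero          f = +-identityʳ (f [])
∑-perms (suc zero)    f = refl
∑-perms (suc (suc n)) f = begin
  ∑ (perms (2 + n)) f
    ≡⟨ ∑-concatMap (insertions (2 + n)) (perms (suc n)) f ⟩
  ∑ (perms (suc n)) (λ p → ∑ (insertions (2 + n) p) f)
    ≡⟨ ∑-perms (suc n) _ ⟩
  permSum n (λ q → ∑ (upTo (suc n)) (λ s → ∑ (insertions (2 + n) (append s q)) f))
    ≡⟨ permSum-cong n (λ {q} _ → insert-max q) ⟩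
  permSum n (λ q → inner q + ∑ (upTo (suc n)) (λ s → f (append s q ∷ʳ (2 + n))))
    ≡⟨ permSum-+ n inner (λ q → ∑ (upTo (suc n)) (λ s → f (append s q ∷ʳ (2 + n)))) ⟩
  permSum n inner + permSum (suc n) (λ p → f (p ∷ʳ (2 + n)))
    ≡⟨ cong₂ _+_ (sym (∑-perms n inner))
         (permSum-cong (suc n) λ P → cong f (sym (append-top P))) ⟩
  ∑ (perms n) inner + permSum (suc n) (λ p → f (append (suc n) p))
    ≡⟨ cong (_+ permSum (suc n) (λ p → f (append (suc n) p)))
         (trans (sym (∑-concatMap (insertions (suc n)) (perms n) low)) (∑-perms (suc n) low)) ⟩
  permSum (suc n) low + permSum (suc n) (λ p → f (append (suc n) p))
    ≡⟨ permSum-+ (suc n) low (λ p → f (append (suc n) p)) ⟨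
  permSum (suc n) (λ p → low p + f (append (suc n) p))
    ≡⟨ permSum-cong (suc n) (λ {p} _ → sym (∑-upTo-last (suc n) (λ s → f (append s p)))) ⟩
  permSum (2 + n) f
    ∎
  where
  open ≡-Reasoning
  low inner : List ℕ → ℕ
  low p   = ∑ (upTo (suc n)) (λ s → f (append s p))
  inner q = ∑ (insertions (suc n) q) low
  insert-max : ∀ q → ∑ (upTo (suc n)) (λ s → ∑ (insertions (2 + n) (append s q)) f) ≡
    inner q + ∑ (upTo (suc n)) (λ s → f (append s q ∷ʳ (2 + n)))
  insert-max q = begin
    ∑ (upTo (suc n)) (λ s → ∑ (insertions (2 + n) (append s q)) f)
      ≡⟨ ∑-upTo-cong (suc n) (λ s s<1+n → trans
           (cong (λ xs → ∑ xs f) (insertions-append q (s≤s⁻¹ s<1+n)))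
           (trans (∑-∷ʳ (map (append s) (insertions (suc n) q)) _ f)
             (cong (_+ f (append s q ∷ʳ (2 + n))) (∑-map (append s) (insertions (suc n) q) f)))) ⟩
    ∑ (upTo (suc n)) (λ s → ∑ (insertions (suc n) q) (f ∘ append s) + f (append s q ∷ʳ (2 + n)))
      ≡⟨ ∑-+ (upTo (suc n)) (λ s → ∑ (insertions (suc n) q) (f ∘ append s)) (λ s → f (append s q ∷ʳ (2 + n))) ⟩
    ∑ (upTo (suc n)) (λ s → ∑ (insertions (suc n) q) (f ∘ append s)) +
    ∑ (upTo (suc n)) (λ s → f (append s q ∷ʳ (2 + n)))
      ≡⟨ cong (_+ ∑ (upTo (suc n)) (λ s → f (append s q ∷ʳ (2 + n))))
           (∑-comm (upTo (suc n)) (insertions (suc n) q) (λ s p → f (append s p))) ⟩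
    inner q + ∑ (upTo (suc n)) (λ s → f (append s q ∷ʳ (2 + n)))
      ∎

-- Prefix flattenings and 321-avoidance

-- `Perm` is generated by `append` without mention of bijectivity. This count supplies what
-- bijectivity is used for: an entry x has rank x, so flattening fixes a permutation.
smaller-perm : ∀ {i p t} → Perm i p → t ≤ i → ∑ p (λ y → indicator (y <ᵇ suc t)) ≡ t
smaller-perm []                                    z≤n = refl
smaller-perm {t = t} (snoc {i} {s} {p} s≤i P) t≤1+i = trans
  (∑-∷ʳ (map (bump s) p) (suc s) (λ y → indicator (y <ᵇ suc t)))
  (trans (cong (_+ indicator (s <ᵇ t)) (∑-map (bump s) p (λ y → indicator (y <ᵇ suc t)))) (cases t t≤1+i))
  where
  high : ∀ t → s ≤ t → suc t ≤ suc i →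
    ∑ p (λ y → indicator (bump s y <ᵇ 2 + t)) + indicator (s <ᵇ suc t) ≡ suc t
  high t s≤t (s≤s t≤i) = begin
    ∑ p (λ y → indicator (bump s y <ᵇ 2 + t)) + indicator (s <ᵇ suc t)
      ≡⟨ cong₂ _+_ (∑-cong p (λ y → cong indicator (bump<ᵇ-high y s≤t)))
                   (cong indicator (<ᵇ-true (s≤s s≤t))) ⟩
    ∑ p (λ y → indicator (y <ᵇ suc t)) + 1
      ≡⟨ cong (_+ 1) (smaller-perm P t≤i) ⟩
    t + 1
      ≡⟨ +-comm t 1 ⟩
    suc t ∎
    where open ≡-Reasoning
  cases : ∀ t → t ≤ suc i → ∑ p (λ y → indicator (bump s y <ᵇ suc t)) + indicator (s <ᵇ t) ≡ t
  cases t t≤1+i with t ≤? s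
  cases t t≤1+i | yes t≤s = begin
    ∑ p (λ y → indicator (bump s y <ᵇ suc t)) + indicator (s <ᵇ t)
      ≡⟨ cong₂ _+_ (∑-cong p (λ y → cong indicator (bump<ᵇ-low y t≤s)))
                   (cong indicator (<ᵇ-false t≤s)) ⟩
    ∑ p (λ y → indicator (y <ᵇ suc t)) + 0
      ≡⟨ +-identityʳ _ ⟩
    ∑ p (λ y → indicator (y <ᵇ suc t))
      ≡⟨ smaller-perm P (≤-trans t≤s s≤i) ⟩
    t ∎
    where open ≡-Reasoning
  cases zero    t≤1+i | no t≰s with () ← t≰s z≤n
  cases (suc t) t≤1+i | no t≰s = high t (s≤s⁻¹ (≰⇒> t≰s)) t≤1+i

any-∷ʳ : ∀ (f : ℕ → Bool) xs x → any f (xs ∷ʳ x) ≡ any f xs ∨ f x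
any-∷ʳ f []       x = ∨-identityʳ (f x)
any-∷ʳ f (y ∷ xs) x = trans (cong (f y ∨_) (any-∷ʳ f xs x)) (sym (∨-assoc (f y) _ _))

any-map : ∀ {f g : ℕ → Bool} {k : ℕ → ℕ} → (∀ x → f (k x) ≡ g x) →
  ∀ xs → any f (map k xs) ≡ any g xs
any-map eq []       = refl
any-map eq (x ∷ xs) = cong₂ _∨_ (eq x) (any-map eq xs)

any-perm : ∀ {i p} → Perm i p → ∀ t → any (λ y → t <ᵇ y) p ≡ (t <ᵇ i)
any-perm []                     t = refl
any-perm (snoc {i} {s} {p} s≤i P) t = trans (any-∷ʳ (λ y → t <ᵇ y) (map (bump s) p) (suc s)) (cases t)
  where
  cases : ∀ t → any (λ y → t <ᵇ y) (map (bump s) p) ∨ (t <ᵇ suc s) ≡ (t <ᵇ suc i)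
  cases t with t ≤? s
  cases t | yes t≤s = trans (cong (any (λ y → t <ᵇ y) (map (bump s) p) ∨_) (<ᵇ-true (s≤s t≤s)))
    (trans (∨-zeroʳ _) (sym (<ᵇ-true (s≤s (≤-trans t≤s s≤i)))))
  cases zero    | no t≰s with () ← t≰s z≤n
  cases (suc t) | no t≰s = trans (cong₂ _∨_ (any-map (λ y → <ᵇbump-high y (s≤s⁻¹ (≰⇒> t≰s))) p) (<ᵇ-false (s≤s⁻¹ (≰⇒> t≰s))))
    (trans (∨-identityʳ _) (any-perm P t))

flatten-perm : ∀ {i p} → Perm i p → flatten p ≡ p
flatten-perm {i} {p} P = map-id-local (All.map (λ {x} → fixed x) (perm-bounded P))
  where
  fixed : ∀ x → 1 ≤ x × x ≤ i → suc (length (filterᵇ (λ y → y <ᵇ x) p)) ≡ x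
  fixed (suc x) (_ , x<i) =
    cong suc (trans (length-filterᵇ (λ y → y <ᵇ suc x) p) (smaller-perm P (<⇒≤ x<i)))

flatten-bump : ∀ s xs → flatten (map (bump s) xs) ≡ flatten xs
flatten-bump s xs = trans (sym (map-∘ xs)) (map-cong (λ x → cong suc (same-rank x)) xs)
  where
  same-rank : ∀ x → length (filterᵇ (λ y → y <ᵇ bump s x) (map (bump s) xs)) ≡
    length (filterᵇ (λ y → y <ᵇ x) xs)
  same-rank x = begin
    length (filterᵇ (λ y → y <ᵇ bump s x) (map (bump s) xs))
      ≡⟨ length-filterᵇ (λ y → y <ᵇ bump s x) (map (bump s) xs) ⟩
    ∑ (map (bump s) xs) (λ y → indicator (y <ᵇ bump s x))
      ≡⟨ ∑-map (bump s) xs (λ y → indicator (y <ᵇ bump s x)) ⟩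
    ∑ xs (λ y → indicator (bump s y <ᵇ bump s x))
      ≡⟨ ∑-cong xs (λ y → cong indicator (bump-<ᵇ s y x)) ⟩
    ∑ xs (λ y → indicator (y <ᵇ x))
      ≡⟨ length-filterᵇ (λ y → y <ᵇ x) xs ⟨
    length (filterᵇ (λ y → y <ᵇ x) xs)
      ∎
    where open ≡-Reasoning

take-∷ʳ : ∀ {i} (xs : List ℕ) x → i ≤ length xs → take i (xs ∷ʳ x) ≡ take i xs
take-∷ʳ {zero}  xs       x _         = refl
take-∷ʳ {suc i} (y ∷ xs) x (s≤s i≤n) = cong (y ∷_) (take-∷ʳ xs x i≤n)

-- Appending relabels the earlier entries monotonically. Hence all extensions of a prefix look the
-- same to the player up to that point.
prefixFlat-append : ∀ {i} s p → i ≤ length p → prefixFlat (append s p) i ≡ prefixFlat p i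
prefixFlat-append {i} s p i≤n = begin
  flatten (take i (map (bump s) p ∷ʳ suc s))
    ≡⟨ cong flatten (take-∷ʳ (map (bump s) p) (suc s) (≤-trans i≤n (≤-reflexive (sym (length-map (bump s) p))))) ⟩
  flatten (take i (map (bump s) p))   ≡⟨ cong flatten (take-map i p) ⟩
  flatten (map (bump s) (take i p))   ≡⟨ flatten-bump s (take i p) ⟩
  flatten (take i p)                  ∎
  where open ≡-Reasoning

prefixFlat-perm : ∀ {i p} → Perm i p → prefixFlat p i ≡ p
prefixFlat-perm {i} {p} P =
  trans (cong flatten (take-all i p (≤-reflexive (length-perm P)))) (flatten-perm P)

-- The largest y that is preceded by an entry exceeding it, or 0 if there is none: a new last
-- entry z completes a 321 pattern exactly when z < bot.
below : ℕ → List ℕ → ℕ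
below x []       = 0
below x (y ∷ ys) = (if y <ᵇ x then y else 0) ⊔ below x ys

bot : List ℕ → ℕ
bot []       = 0
bot (x ∷ xs) = below x xs ⊔ bot xs

∨-commutativeSemigroup : CommutativeSemigroup _ _
∨-commutativeSemigroup = CommutativeMonoid.commutativeSemigroup ∨-commutativeMonoid

<ᵇ-if : ∀ b z y → (z <ᵇ (if b then y else 0)) ≡ b ∧ (z <ᵇ y)
<ᵇ-if true  z y = refl
<ᵇ-if false z y = refl

-- With x as the 3, the entry z becomes the 1 of a new pattern iff it lies below some later y < x,
-- that is, below the largest such y.
has21below-∷ʳ : ∀ x xs z → has21below x (xs ∷ʳ z) ≡ has21below x xs ∨ (z <ᵇ below x xs)
has21below-∷ʳ x []       z = trans (∨-identityʳ _) (∧-zeroʳ (z <ᵇ x))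
has21below-∷ʳ x (y ∷ ys) z = begin
  ((y <ᵇ x) ∧ any (λ w → w <ᵇ y) (ys ∷ʳ z)) ∨ has21below x (ys ∷ʳ z)
    ≡⟨ cong₂ _∨_ (trans (cong ((y <ᵇ x) ∧_) (any-∷ʳ (λ w → w <ᵇ y) ys z)) (∧-distribˡ-∨ (y <ᵇ x) _ _)) (has21below-∷ʳ x ys z) ⟩
  (((y <ᵇ x) ∧ any (λ w → w <ᵇ y) ys) ∨ ((y <ᵇ x) ∧ (z <ᵇ y))) ∨ (has21below x ys ∨ (z <ᵇ below x ys))
    ≡⟨ interchange ∨-commutativeSemigroup ((y <ᵇ x) ∧ any (λ w → w <ᵇ y) ys) _ _ _ ⟩
  has21below x (y ∷ ys) ∨ (((y <ᵇ x) ∧ (z <ᵇ y)) ∨ (z <ᵇ below x ys))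
    ≡⟨ cong (has21below x (y ∷ ys) ∨_) (trans (cong (_∨ (z <ᵇ below x ys)) (sym (<ᵇ-if (y <ᵇ x) z y)))
         (sym (<ᵇ-⊔ z (if y <ᵇ x then y else 0) (below x ys)))) ⟩
  has21below x (y ∷ ys) ∨ (z <ᵇ below x (y ∷ ys)) ∎
  where open ≡-Reasoning

contains321-∷ʳ : ∀ xs z → contains321 (xs ∷ʳ z) ≡ contains321 xs ∨ (z <ᵇ bot xs)
contains321-∷ʳ []       z = refl
contains321-∷ʳ (x ∷ xs) z = begin
  has21below x (xs ∷ʳ z) ∨ contains321 (xs ∷ʳ z)
    ≡⟨ cong₂ _∨_ (has21below-∷ʳ x xs z) (contains321-∷ʳ xs z) ⟩
  (has21below x xs ∨ (z <ᵇ below x xs)) ∨ (contains321 xs ∨ (z <ᵇ bot xs))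
    ≡⟨ interchange ∨-commutativeSemigroup (has21below x xs) _ _ _ ⟩
  contains321 (x ∷ xs) ∨ ((z <ᵇ below x xs) ∨ (z <ᵇ bot xs))
    ≡⟨ cong (contains321 (x ∷ xs) ∨_) (<ᵇ-⊔ z (below x xs) (bot xs)) ⟨
  contains321 (x ∷ xs) ∨ (z <ᵇ bot (x ∷ xs)) ∎
  where open ≡-Reasoning

has21below-bump : ∀ s x xs → has21below (bump s x) (map (bump s) xs) ≡ has21below x xs
has21below-bump s x []       = refl
has21below-bump s x (y ∷ ys) =
  cong₂ _∨_ (cong₂ _∧_ (bump-<ᵇ s y x) (any-map (λ w → bump-<ᵇ s w y) ys)) (has21below-bump s x ys)

contains321-bump : ∀ s xs → contains321 (map (bump s) xs) ≡ contains321 xs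
contains321-bump s []       = refl
contains321-bump s (x ∷ xs) = cong₂ _∨_ (has21below-bump s x xs) (contains321-bump s xs)

below-bump : ∀ s x xs → below (bump s x) (map (bump s) xs) ≡ bump s (below x xs)
below-bump s x []       = refl
below-bump s x (y ∷ ys) rewrite bump-<ᵇ s y x = trans
  (cong₂ _⊔_ (sym (if-float (bump s) (y <ᵇ x))) (below-bump s x ys)) (sym (bump-⊔ s (if y <ᵇ x then y else 0) (below x ys)))

bot-bump : ∀ s xs → bot (map (bump s) xs) ≡ bump s (bot xs)
bot-bump s []       = refl
bot-bump s (x ∷ xs) =
  trans (cong₂ _⊔_ (below-bump s x xs) (bot-bump s xs)) (sym (bump-⊔ s (below x xs) (bot xs)))

contains321-append : ∀ s p → contains321 (append s p) ≡ contains321 p ∨ (s <ᵇ bot p)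
contains321-append s p = trans (contains321-∷ʳ (map (bump s) p) (suc s)) (cong₂ _∨_
  (contains321-bump s p) (trans (cong (suc s <ᵇ_) (bot-bump s p)) (<ᵇbump-high (bot p) ≤-refl)))

below-∷ʳ : ∀ x xs z → below x (xs ∷ʳ z) ≡ below x xs ⊔ (if z <ᵇ x then z else 0)
below-∷ʳ x []       z = ⊔-identityʳ _
below-∷ʳ x (y ∷ ys) z = trans (cong ((if y <ᵇ x then y else 0) ⊔_) (below-∷ʳ x ys z))
  (sym (⊔-assoc (if y <ᵇ x then y else 0) _ _))

bot-∷ʳ : ∀ xs z → bot (xs ∷ʳ z) ≡ bot xs ⊔ (if any (λ x → z <ᵇ x) xs then z else 0)
bot-∷ʳ []       z = refl
bot-∷ʳ (x ∷ xs) z = begin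
  below x (xs ∷ʳ z) ⊔ bot (xs ∷ʳ z)
    ≡⟨ cong₂ _⊔_ (below-∷ʳ x xs z) (bot-∷ʳ xs z) ⟩
  (below x xs ⊔ (if z <ᵇ x then z else 0)) ⊔ (bot xs ⊔ (if any (λ x → z <ᵇ x) xs then z else 0))
    ≡⟨ interchange ⊔-commutativeSemigroup (below x xs) _ _ _ ⟩
  bot (x ∷ xs) ⊔ ((if z <ᵇ x then z else 0) ⊔ (if any (λ x → z <ᵇ x) xs then z else 0))
    ≡⟨ cong (bot (x ∷ xs) ⊔_) (if-⊔ (z <ᵇ x) (any (λ x → z <ᵇ x) xs)) ⟩
  bot (x ∷ xs) ⊔ (if any (λ x → z <ᵇ x) (x ∷ xs) then z else 0) ∎
  where
  open ≡-Reasoning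
  if-⊔ : ∀ a b → (if a then z else 0) ⊔ (if b then z else 0) ≡ (if a ∨ b then z else 0)
  if-⊔ true  true  = ⊔-idem z
  if-⊔ true  false = ⊔-identityʳ z
  if-⊔ false b     = refl

-- The new entry is the lower end of a 21 pattern iff it is not a new maximum, and then it lies
-- above the old `bot`.
bot-append : ∀ {i s p} → Perm i p → bot p ≤ s →
  bot (append s p) ≡ bot p ⊔ (if s <ᵇ i then suc s else 0)
bot-append {i} {s} {p} P bot≤s = trans (bot-∷ʳ (map (bump s) p) (suc s)) (cong₂ _⊔_
  (trans (bot-bump s p) (bump-≤ bot≤s))
  (cong (λ b → if b then suc s else 0) (trans (any-map (λ x → <ᵇbump-high x ≤-refl) p) (any-perm P s))))

bot-append-low : ∀ {i s p} → Perm i p → bot p ≤ s → s < i → bot (append s p) ≡ suc s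
bot-append-low {s = s} {p} P bot≤s s<i = trans (bot-append P bot≤s) (trans
  (cong (λ b → bot p ⊔ (if b then suc s else 0)) (<ᵇ-true s<i)) (m≤n⇒m⊔n≡n (m≤n⇒m≤1+n bot≤s)))

bot-append-top : ∀ {i p} → Perm i p → bot p ≤ i → bot (append i p) ≡ bot p
bot-append-top {i} {p} P bot≤i = trans (bot-append P bot≤i) (trans
  (cong (λ b → bot p ⊔ (if b then suc i else 0)) (<ᵇ-false (≤-refl {i}))) (⊔-identityʳ (bot p)))

-- Sums over the 321-avoiding extensions of a prefix

-- The state j counts the values above `bot p`; the additive form avoids truncated subtraction.
Node : ℕ → ℕ → List ℕ → Set
Node i j p = Perm i p × bot p + j ≡ i

-- With t ≥ 1 old values above it, the new entry has value i - t + 1 and becomes the new `bot`,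
-- leaving t values above.
node-low : ∀ {i j p t} → Node i j p → 1 ≤ t → t ≤ j → Node (suc i) t (append (i ∸ t) p)
node-low {i} {j} {p} {t} (P , b+j≡i) 1≤t t≤j =
  snoc (m∸n≤m i t) P , trans (cong (_+ t) (bot-append-low P bot≤i∸t i∸t<i)) (cong suc (m∸n+n≡m t≤i))
  where
  t≤i : t ≤ i
  t≤i = ≤-trans t≤j (≤-trans (m≤n+m j (bot p)) (≤-reflexive b+j≡i))
  bot≤i∸t : bot p ≤ i ∸ t
  bot≤i∸t = m+n≤o⇒m≤o∸n (bot p) (≤-trans (+-monoʳ-≤ (bot p) t≤j) (≤-reflexive b+j≡i))
  i∸t<i : i ∸ t < i
  i∸t<i = ∸-monoʳ-< 1≤t t≤i

node-top : ∀ {i j p} → Node i j p → Node (suc i) (suc j) (append i p)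
node-top {i} {j} {p} (P , b+j≡i) = snoc ≤-refl P , trans
  (cong (_+ suc j) (bot-append-top P (≤-trans (m≤m+n (bot p) j) (≤-reflexive b+j≡i))))
  (trans (+-suc (bot p) j) (cong suc b+j≡i))

-- The sum of f over the 321-avoiding extensions of p by n entries, provided Node i j p.
extSum : ℕ → ℕ → ℕ → List ℕ → (List ℕ → ℕ) → ℕ
extSum zero    i j p f = f p
extSum (suc n) i j p f =
  sumTo (λ t → extSum n (suc i) t (append (i ∸ t) p) f) j + extSum n (suc i) (suc j) (append i p) f

children : List ℕ → (List ℕ → ℕ) → ℕ
children p f = ∑ (upTo (suc (length p))) (λ s → if s <ᵇ bot p then 0 else f (append s p))

-- The substitution is s = m + j - t. The value t = 0, a new maximum, lies outside this range and is
-- treated separately.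
∑-upTo-sumTo : ∀ m j (f : ℕ → ℕ) →
  ∑ (upTo (m + j)) (λ s → if s <ᵇ m then 0 else f s) ≡ sumTo (λ t → f (m + j ∸ t)) j
∑-upTo-sumTo zero zero    f = refl
∑-upTo-sumTo zero (suc j) f = trans (∑-upTo-first j f) (cong₂ _+_ (cong f (sym (n∸n≡0 j)))
  (trans (∑-upTo-sumTo zero j (f ∘ suc))
    (sumTo-cong j λ t _ t≤j → cong f (sym (+-∸-assoc 1 t≤j)))))
∑-upTo-sumTo (suc m) j f = trans
  (∑-upTo-first (m + j) (λ s → if s <ᵇ suc m then 0 else f s))
  (trans (∑-upTo-sumTo m j (f ∘ suc))
    (sumTo-cong j λ t _ t≤j → cong f (sym (+-∸-assoc 1 (≤-trans t≤j (m≤n+m j m))))))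

children-node : ∀ {i j p} → Node i j p → ∀ f →
  children p f ≡ sumTo (λ t → f (append (i ∸ t) p)) j + f (append i p)
children-node {i} {j} {p} (P , refl) f
  rewrite length-perm P = trans
    (∑-upTo-last (bot p + j) (λ s → if s <ᵇ bot p then 0 else f (append s p)))
    (cong₂ _+_ (∑-upTo-sumTo (bot p) j (λ s → f (append s p)))
      (cong (λ b → if b then 0 else f (append (bot p + j) p)) (<ᵇ-false (m≤m+n (bot p) j))))

-- `extSum` splits off the first new entry, as the game requires; here the last one is split off
-- instead, to match `permSum`.
extSum-children : ∀ n {i j p} → Node i j p → ∀ f →
  extSum (suc n) i j p f ≡ extSum n i j p (λ q → children q f)
extSum-children zero    node f = sym (children-node node f)
extSum-children (suc n) {i} {j} node f = cong₂ _+_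
  (sumTo-cong j λ t 1≤t t≤j → extSum-children n (node-low node 1≤t t≤j) f)
  (extSum-children n (node-top node) f)

-- All extensions of `p` have `p` as their flattening at i. This turns decisions based on that
-- flattening into constants over the sum.
extSum-cong : ∀ n {i j p f g} → Perm i p →
  (∀ π → prefixFlat π i ≡ p → f π ≡ g π) → extSum n i j p f ≡ extSum n i j p g
extSum-cong n {i} {j} {p} {f} {g} P f≗g = go n i j p (≤-reflexive (sym (length-perm P))) (prefixFlat-perm P)
  where
  go : ∀ n i′ j q → i ≤ length q → prefixFlat q i ≡ p → extSum n i′ j q f ≡ extSum n i′ j q g
  go zero    i′ j q i≤ q|i≡p = f≗g q q|i≡p
  go (suc n) i′ j q i≤ q|i≡p = cong₂ _+_ (sumTo-cong j λ t _ _ → child t (i′ ∸ t)) (child (suc j) i′)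
    where
    child : ∀ t s → extSum n (suc i′) t (append s q) f ≡ extSum n (suc i′) t (append s q) g
    child t s = go n (suc i′) t (append s q)
      (≤-trans (m≤n⇒m≤1+n i≤) (≤-reflexive (sym (length-append s q))))
      (trans (prefixFlat-append s q i≤) q|i≡p)

-- The identity prefix and the sample space

idPerm-suc : ∀ k → idPerm (suc k) ≡ idPerm k ∷ʳ suc k
idPerm-suc k = sym (applyUpTo-∷ʳ suc k)

idPerm-node : ∀ k → Node k k (idPerm k)
idPerm-node zero    = [] , refl
idPerm-node (suc k) = subst (Node (suc k) (suc k)) (trans (append-top (proj₁ IH)) (sym (idPerm-suc k))) (node-top IH)
  where
  IH : Node k k (idPerm k)
  IH = idPerm-node k

idPerm-append : ∀ k → append k (idPerm k) ≡ idPerm (suc k)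
idPerm-append k = trans (append-top (proj₁ (idPerm-node k))) (sym (idPerm-suc k))

bot-idPerm : ∀ k → bot (idPerm k) ≡ 0
bot-idPerm k = +-cancelʳ-≡ k (bot (idPerm k)) 0 (proj₂ (idPerm-node k))

contains321-idPerm : ∀ k → contains321 (idPerm k) ≡ false
contains321-idPerm zero    = refl
contains321-idPerm (suc k) = begin
  contains321 (idPerm (suc k))                        ≡⟨ cong contains321 (idPerm-append k) ⟨
  contains321 (append k (idPerm k))                   ≡⟨ contains321-append k (idPerm k) ⟩
  contains321 (idPerm k) ∨ (k <ᵇ bot (idPerm k))      ≡⟨ cong₂ (λ b m → b ∨ (k <ᵇ m)) (contains321-idPerm k) (bot-idPerm k) ⟩
  false                                               ∎
  where open ≡-Reasoning

listEqᵇ-∷ʳ : ∀ xs ys x y → listEqᵇ (xs ∷ʳ x) (ys ∷ʳ y) ≡ listEqᵇ xs ys ∧ (x ≡ᵇ y)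
listEqᵇ-∷ʳ []            []            x y = ∧-identityʳ (x ≡ᵇ y)
listEqᵇ-∷ʳ []            (_ ∷ [])      x y = ∧-zeroʳ (x ≡ᵇ _)
listEqᵇ-∷ʳ []            (_ ∷ _ ∷ _)   x y = ∧-zeroʳ (x ≡ᵇ _)
listEqᵇ-∷ʳ (z ∷ [])      []            x y = ∧-zeroʳ (z ≡ᵇ y)
listEqᵇ-∷ʳ (z ∷ _ ∷ _)   []            x y = ∧-zeroʳ (z ≡ᵇ y)
listEqᵇ-∷ʳ (z ∷ xs)      (w ∷ ys)      x y =
  trans (cong ((z ≡ᵇ w) ∧_) (listEqᵇ-∷ʳ xs ys x y)) (sym (∧-assoc (z ≡ᵇ w) _ _))

permSum-idPerm : ∀ k f →
  permSum k (λ p → if listEqᵇ p (idPerm k) then f p else 0) ≡ f (idPerm k)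
permSum-idPerm zero    f = refl
permSum-idPerm (suc k) f = begin
  permSum k (λ p → ∑ (upTo (suc k)) (λ s → term s p))
    ≡⟨ permSum-cong k last-forced ⟩
  permSum k (λ p → if listEqᵇ p (idPerm k) then f (append k p) else 0)
    ≡⟨ permSum-idPerm k (f ∘ append k) ⟩
  f (append k (idPerm k))
    ≡⟨ cong f (idPerm-append k) ⟩
  f (idPerm (suc k)) ∎
  where
  open ≡-Reasoning
  term : ℕ → List ℕ → ℕ
  term s p = if listEqᵇ (append s p) (idPerm (suc k)) then f (append s p) else 0
  match : ∀ s p → listEqᵇ (append s p) (idPerm (suc k)) ≡ listEqᵇ (map (bump s) p) (idPerm k) ∧ (s ≡ᵇ k)
  match s p = trans (cong (listEqᵇ (append s p)) (idPerm-suc k))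
    (listEqᵇ-∷ʳ (map (bump s) p) (idPerm k) (suc s) (suc k))
  last-forced : ∀ {p} → Perm k p →
    ∑ (upTo (suc k)) (λ s → term s p) ≡ (if listEqᵇ p (idPerm k) then f (append k p) else 0)
  last-forced {p} P = trans (∑-upTo-last k (λ s → term s p)) (cong₂ _+_
    (trans (∑-upTo-cong k λ s s<k → cong (λ b → if b then f (append s p) else 0)
        (trans (match s p) (trans (cong (listEqᵇ (map (bump s) p) (idPerm k) ∧_) (<⇒≡ᵇ-false s<k)) (∧-zeroʳ _))))
      (∑-0 (upTo k)))
    (cong (λ b → if b then f (append k p) else 0) (trans (match k p) (trans
      (cong₂ (λ q b → listEqᵇ q (idPerm k) ∧ b)
        (map-id-local (All.map (bump-≤ ∘ proj₂) (perm-bounded P))) (≡ᵇ-refl k))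
      (∧-identityʳ _)))))

inSpace : ℕ → List ℕ → Bool
inSpace k π = Avoids321 π ∧ listEqᵇ (prefixFlat π k) (idPerm k)

-- Induction on n by removing the last entry: an extension lies in the space iff its prefix does and
-- s is not below `bot p`, which is the guard in `children`.
permSum-inSpace : ∀ n k f →
  permSum (n + k) (λ π → if inSpace k π then f π else 0) ≡ extSum n k k (idPerm k) f
permSum-inSpace zero    k f = begin
  permSum k (λ π → if inSpace k π then f π else 0)
    ≡⟨ permSum-cong k (λ {p} P → trans (cong (λ q → if Avoids321 p ∧ listEqᵇ q (idPerm k) then f p else 0) (prefixFlat-perm P))
         (if-∧-if (Avoids321 p) (listEqᵇ p (idPerm k)))) ⟩
  permSum k (λ p → if listEqᵇ p (idPerm k) then (if Avoids321 p then f p else 0) else 0)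
    ≡⟨ permSum-idPerm k (λ p → if Avoids321 p then f p else 0) ⟩
  (if Avoids321 (idPerm k) then f (idPerm k) else 0)
    ≡⟨ cong (λ b → if not b then f (idPerm k) else 0) (contains321-idPerm k) ⟩
  f (idPerm k) ∎
  where
  open ≡-Reasoning
  if-∧-if : ∀ a b {x : ℕ} → (if a ∧ b then x else 0) ≡ (if b then (if a then x else 0) else 0)
  if-∧-if true  b     = refl
  if-∧-if false true  = refl
  if-∧-if false false = refl
permSum-inSpace (suc n) k f = begin
  permSum (n + k) (λ p → ∑ (upTo (suc (n + k))) (λ s → if inSpace k (append s p) then f (append s p) else 0))
    ≡⟨ permSum-cong (n + k) step ⟩
  permSum (n + k) (λ p → if inSpace k p then children p f else 0)
    ≡⟨ permSum-inSpace n k (λ p → children p f) ⟩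
  extSum n k k (idPerm k) (λ p → children p f)
    ≡⟨ extSum-children n (idPerm-node k) f ⟨
  extSum (suc n) k k (idPerm k) f ∎
  where
  open ≡-Reasoning
  split : ∀ c l e (x : ℕ) →
    (if not (c ∨ l) ∧ e then x else 0) ≡ (if not c ∧ e then (if l then 0 else x) else 0)
  split true  l     e     x = refl
  split false true  true  x = refl
  split false true  false x = refl
  split false false e     x = refl
  ∑-if : ∀ b (xs : List ℕ) (g : ℕ → ℕ) → ∑ xs (λ s → if b then g s else 0) ≡ (if b then ∑ xs g else 0)
  ∑-if true  xs g = refl
  ∑-if false xs g = ∑-0 xs
  step : ∀ {p} → Perm (n + k) p →
    ∑ (upTo (suc (n + k))) (λ s → if inSpace k (append s p) then f (append s p) else 0) ≡
    (if inSpace k p then children p f else 0)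
  step {p} P = begin
    ∑ (upTo (suc (n + k))) (λ s → if inSpace k (append s p) then f (append s p) else 0)
      ≡⟨ ∑-cong (upTo (suc (n + k))) (λ s → trans
           (cong₂ (λ c q → if not c ∧ listEqᵇ q (idPerm k) then f (append s p) else 0)
             (contains321-append s p)
             (prefixFlat-append s p (≤-trans (m≤n+m k n) (≤-reflexive (sym (length-perm P))))))
           (split (contains321 p) (s <ᵇ bot p) (listEqᵇ (prefixFlat p k) (idPerm k)) (f (append s p)))) ⟩
    ∑ (upTo (suc (n + k))) (λ s → if inSpace k p then (if s <ᵇ bot p then 0 else f (append s p)) else 0)
      ≡⟨ ∑-if (inSpace k p) (upTo (suc (n + k))) _ ⟩
    (if inSpace k p then ∑ (upTo (suc (n + k))) (λ s → if s <ᵇ bot p then 0 else f (append s p)) else 0)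
      ≡⟨ cong (λ l → if inSpace k p then ∑ (upTo (suc l)) (λ s → if s <ᵇ bot p then 0 else f (append s p)) else 0) (length-perm P) ⟨
    (if inSpace k p then children p f else 0) ∎

∑-Space : ∀ n k f → ∑ (Space (n + k) k) f ≡ extSum n k k (idPerm k) f
∑-Space n k f = trans (∑-filterᵇ (inSpace k) (perms (n + k)) f)
  (trans (∑-perms (n + k) _) (permSum-inSpace n k f))

-- The game

at-map : ∀ f xs c {v} → at xs c ≡ just v → at (map f xs) c ≡ just (f v)
at-map f (x ∷ xs) (suc zero)    refl = refl
at-map f (x ∷ xs) (suc (suc c)) eq   = at-map f xs (suc c) eq

at-∷ʳ : ∀ xs z c {v} → at xs c ≡ just v → at (xs ∷ʳ z) c ≡ just v
at-∷ʳ (x ∷ xs) z (suc zero)    refl = refl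
at-∷ʳ (x ∷ xs) z (suc (suc c)) eq   = at-∷ʳ xs z (suc c) eq

at-∷ʳ-last : ∀ xs z → at (xs ∷ʳ z) (suc (length xs)) ≡ just z
at-∷ʳ-last []       z = refl
at-∷ʳ-last (x ∷ xs) z = at-∷ʳ-last xs z

at-0 : ∀ xs → at xs 0 ≡ nothing
at-0 []       = refl
at-0 (x ∷ xs) = refl

at-append : ∀ s p c {v} → at p c ≡ just v → at (append s p) c ≡ just (bump s v)
at-append s p c eq = at-∷ʳ (map (bump s) p) (suc s) c (at-map (bump s) p c eq)

at-append-last : ∀ {i p} s → Perm i p → at (append s p) (suc i) ≡ just (suc s)
at-append-last {p = p} s P = subst (λ l → at (append s p) (suc l) ≡ just (suc s))
  (trans (length-map (bump s) p) (length-perm P)) (at-∷ʳ-last (map (bump s) p) (suc s))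

-- An entry below the maximum of its prefix stays below it under every extension.
extSum-nonmax : ∀ n {i j q c v N} → n + i ≡ N → at q c ≡ just v → v < i →
  extSum n i j q (λ π → indicator (maybeEqᵇ (at π c) N)) ≡ 0
extSum-nonmax zero    refl atq v<i rewrite atq = cong indicator (<⇒≡ᵇ-false v<i)
extSum-nonmax (suc n) {i} {j} {q} {c} {v} {N} eq atq v<i = cong₂ _+_
  (trans (sumTo-cong j λ t _ _ → child t (i ∸ t)) (sumTo-0 j))
  (child (suc j) i)
  where
  child : ∀ t s → extSum n (suc i) t (append s q) (λ π → indicator (maybeEqᵇ (at π c) N)) ≡ 0
  child t s = extSum-nonmax n (trans (+-suc n i) eq) (at-append s q c atq) (s≤s (≤-trans (bump-bound s ≤-refl) v<i))

-- The entry at c remains the maximum exactly when no new maximum is appended, so only the low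
-- children contribute; this is the recursion of `wins`.
extSum-max : ∀ n {i j q c N} → n + i ≡ N → Node i j q → at q c ≡ just i →
  extSum n i j q (λ π → indicator (maybeEqᵇ (at π c) N)) ≡ wins n j
extSum-max zero    {i} refl node atq rewrite atq = cong indicator (≡ᵇ-refl i)
extSum-max (suc n) {i} {j} {q} {c} {N} eq node@(P , b+j≡i) atq = trans (cong₂ _+_
  (sumTo-cong j λ t 1≤t t≤j → extSum-max n (trans (+-suc n i) eq) (node-low node 1≤t t≤j)
    (trans (at-append (i ∸ t) q c atq) (cong just (bump-> (∸-monoʳ-< 1≤t (≤-trans t≤j j≤i))))))
  (extSum-nonmax n {j = suc j} {q = append i q} {c = c} (trans (+-suc n i) eq)
    (trans (at-append i q c atq) (cong just (bump-≤ ≤-refl))) ≤-refl))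
  (+-identityʳ _)
  where
  j≤i : j ≤ i
  j≤i = ≤-trans (m≤n+m j (bot q)) (≤-reflexive b+j≡i)

remaining : ℕ → ℕ → List ℕ
remaining i zero    = []
remaining i (suc n) = suc i ∷ remaining (suc i) n

candidates-remaining : ∀ n k → candidates (n + k) k ≡ remaining k n
candidates-remaining n k =
  trans (cong (applyUpTo (λ j → suc (k + j))) (m+n∸n≡m n k)) (go k n (λ j → suc (k + j)) λ _ → refl)
  where
  go : ∀ k n f → (∀ j → f j ≡ suc (k + j)) → applyUpTo f n ≡ remaining k n
  go k zero    f f≗ = refl
  go k (suc n) f f≗ = cong₂ _∷_ (trans (f≗ 0) (cong suc (+-identityʳ k)))
    (go (suc k) n (f ∘ suc) λ j → trans (f≗ (suc j)) (cong suc (+-suc k j)))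

-- The last candidate is accepted whatever the strategy says.
stops : ℕ → Bool → Bool
stops zero    b = true
stops (suc n) b = b

module _ (N : ℕ) (σ : Strategy) where

  winAt : ℕ → List ℕ → ℕ
  winAt c π = indicator (maybeEqᵇ (at π c) N)

  win : List (List ℕ) → List ℕ → List ℕ → ℕ
  win h cs π = winAt (play σ π h cs) π

  -- Every extension of `q` shows the same flattening `q` at this moment, so the decision is one
  -- Boolean and moves out of the sum.
  extSum-reveal : ∀ n {i j q h} → Perm (suc i) q →
    extSum n (suc i) j q (win h (remaining i (suc n))) ≡
    (if stops n (σ (h ∷ʳ q))
      then extSum n (suc i) j q (winAt (suc i))
      else extSum n (suc i) j q (win (h ∷ʳ q) (remaining (suc i) n)))
  extSum-reveal zero    P = refl
  extSum-reveal (suc n) {i} {j} {q} {h} P = trans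
    (extSum-cong (suc n) {j = j} {f = win h (remaining i (2 + n))} {g = continue (σ (h ∷ʳ q)) q} P
      λ π π|i≡q → cong (λ r → continue (σ (h ∷ʳ r)) r π) π|i≡q)
    (decide (σ (h ∷ʳ q)))
    where
    -- The flattening enters both the decision and the later history; abstracting it as `r` replaces
    -- both occurrences at once.
    continue : Bool → List ℕ → List ℕ → ℕ
    continue b r π = winAt (if b then suc i else play σ π (h ∷ʳ r) (remaining (suc i) (suc n))) π
    decide : ∀ b → extSum (suc n) (suc i) j q (continue b q) ≡
      (if b then extSum (suc n) (suc i) j q (winAt (suc i))
            else extSum (suc n) (suc i) j q (win (h ∷ʳ q) (remaining (suc i) (suc n))))
    decide true  = refl
    decide false = refl

  module _ {n i j p} (eq : suc n + i ≡ N) (node : Node i j p) where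

    n+1+i≡N : n + suc i ≡ N
    n+1+i≡N = trans (+-suc n i) eq

    accept-low : ∀ {t} → 1 ≤ t → t ≤ j →
      extSum n (suc i) t (append (i ∸ t) p) (winAt (suc i)) ≡ 0
    accept-low {t} 1≤t t≤j = extSum-nonmax n {c = suc i} n+1+i≡N (at-append-last (i ∸ t) (proj₁ node))
      (s≤s (∸-monoʳ-< 1≤t (≤-trans t≤j (≤-trans (m≤n+m j (bot p)) (≤-reflexive (proj₂ node))))))

    accept-top : extSum n (suc i) (suc j) (append i p) (winAt (suc i)) ≡ wins n (suc j)
    accept-top = extSum-max n {c = suc i} n+1+i≡N (node-top node) (at-append-last i (proj₁ node))

  if-≤ : ∀ b {x y z} → x ≤ z → y ≤ z → (if b then x else y) ≤ z
  if-≤ true  x≤z y≤z = x≤z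
  if-≤ false x≤z y≤z = y≤z

  -- At a low child acceptance wins nothing and rejection at most the inductive value; at the top
  -- child both choices are bounded by the maximum in `value`.
  extSum-win≤value : ∀ n {i j p h} → n + i ≡ N → Node i j p →
    extSum n i j p (win h (remaining i n)) ≤ value n j
  -- With no candidates left `play` returns 0, a position that holds no entry.
  extSum-win≤value zero    {p = p} eq node rewrite at-0 p = z≤n
  extSum-win≤value (suc n) {i} {j} {p} {h} eq node = +-mono-≤
    (sumTo-mono j λ t 1≤t t≤j → ≤-trans
      (≤-reflexive (extSum-reveal n (proj₁ (node-low node 1≤t t≤j))))
      (if-≤ (stops n (σ (h ∷ʳ append (i ∸ t) p)))
        (≤-trans (≤-reflexive (accept-low eq node 1≤t t≤j)) z≤n)
        (extSum-win≤value n (n+1+i≡N eq node) (node-low node 1≤t t≤j))))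
    (≤-trans
      (≤-reflexive (extSum-reveal n (proj₁ (node-top node))))
      (if-≤ (stops n (σ (h ∷ʳ append i p)))
        (≤-trans (≤-reflexive (accept-top eq node)) (m≤m⊔n _ _))
        (≤-trans (extSum-win≤value n (n+1+i≡N eq node) (node-top node)) (m≤n⊔m (wins n (suc j)) _))))

-- Accept a left-to-right maximum when stopping is at least as good as continuing; the parameters n
-- and j are read off from the current flattening.
accepts : ℕ → List ℕ → Bool
accepts N q = maybeEqᵇ (at q (length q)) (length q) ∧ (value n j ≤ᵇ wins n j)
  where
  n j : ℕ
  n = N ∸ length q
  j = length q ∸ bot q

-- The fold keeps the last item of the history, the current flattening, which determines the earlier
-- ones.
optimal : ℕ → Strategy
optimal N h = accepts N (foldl (λ _ q → q) [] h)

optimal-∷ʳ : ∀ N h q → optimal N (h ∷ʳ q) ≡ accepts N q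
optimal-∷ʳ N h q = cong (accepts N) (foldl-∷ʳ (λ _ q → q) [] q h)

accepts-low : ∀ {N i s p} → Perm i p → s < i → accepts N (append s p) ≡ false
accepts-low {N} {i} {s} {p} P s<i
  rewrite trans (length-append s p) (cong suc (length-perm P)) | at-append-last s P | <⇒≡ᵇ-false s<i = refl

accepts-top : ∀ {N n i j p} → suc n + i ≡ N → Node i j p →
  accepts N (append i p) ≡ (value n (suc j) ≤ᵇ wins n (suc j))
accepts-top {N} {n} {i} {j} {p} refl node@(P , b+j≡i)
  rewrite trans (length-append i p) (cong suc (length-perm P)) | at-append-last i P | ≡ᵇ-refl i
  = cong₂ (λ m l → value m l ≤ᵇ wins m l) (m+n∸n≡m n i)
      (trans (cong (_∸ bot (append i p)) (sym (proj₂ (node-top node)))) (m+n∸m≡n (bot (append i p)) (suc j)))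

-- The bound of `extSum-win≤value` is attained: low children are rejected and the top child takes
-- the larger of its two options.
extSum-optimal : ∀ N n {i j p h} → n + i ≡ N → Node i j p →
  extSum n i j p (win N (optimal N) h (remaining i n)) ≡ value n j
extSum-optimal N zero    {p = p} eq node rewrite at-0 p = refl
extSum-optimal N (suc n) {i} {j} {p} {h} eq node = cong₂ _+_
  (sumTo-cong j λ t 1≤t t≤j → trans
    (extSum-reveal N (optimal N) n (proj₁ (node-low node 1≤t t≤j)))
    (trans
      (cong₂ (λ x y → if stops n (optimal N (h ∷ʳ append (i ∸ t) p)) then x else y)
        (accept-low N (optimal N) eq node 1≤t t≤j)
        (extSum-optimal N n eq′ (node-low node 1≤t t≤j)))
      (reject n t (trans (optimal-∷ʳ N h (append (i ∸ t) p))
        (accepts-low {N} (proj₁ node) (∸-monoʳ-< 1≤t (≤-trans t≤j j≤i)))))))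
  (trans
    (extSum-reveal N (optimal N) n (proj₁ (node-top node)))
    (trans
      (cong₂ (λ x y → if stops n (optimal N (h ∷ʳ append i p)) then x else y)
        (accept-top N (optimal N) eq node)
        (extSum-optimal N n eq′ (node-top node)))
      (best n (trans (optimal-∷ʳ N h (append i p)) (accepts-top eq node)))))
  where
  eq′ : n + suc i ≡ N
  eq′ = trans (+-suc n i) eq
  j≤i : j ≤ i
  j≤i = ≤-trans (m≤n+m j (bot p)) (≤-reflexive (proj₂ node))
  -- At the last candidate acceptance is forced, but it wins 0, which is also `value 0 t`.
  reject : ∀ n t {b} → b ≡ false → (if stops n b then 0 else value n t) ≡ value n t
  reject zero    t refl = refl
  reject (suc n) t refl = refl
  best : ∀ n {b} → b ≡ (value n (suc j) ≤ᵇ wins n (suc j)) →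
    (if stops n b then wins n (suc j) else value n (suc j)) ≡ wins n (suc j) ⊔ value n (suc j)
  best zero    _    = refl
  best (suc n) refl with value (suc n) (suc j) ≤ᵇ wins (suc n) (suc j) in eq
  ... | true  = sym (m≥n⇒m⊔n≡m (≤ᵇ⇒≤ _ _ (subst T (sym eq) _)))
  ... | false = sym (m≤n⇒m⊔n≡n (≰⇒≥ λ v≤w → subst T eq (≤⇒≤ᵇ v≤w)))

count-S : ∀ n k →
  length (filterᵇ (λ π → maybeEqᵇ (at π (suc k)) (n + suc k)) (Space (n + suc k) (suc k))) ≡ wins n (suc k)
count-S n k = trans
  (length-filterᵇ (λ π → maybeEqᵇ (at π (suc k)) (n + suc k)) (Space (n + suc k) (suc k)))
  (trans (∑-Space n (suc k) (λ π → indicator (maybeEqᵇ (at π (suc k)) (n + suc k))))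
    (extSum-max n {c = suc k} refl (idPerm-node (suc k))
      (subst (λ q → at q (suc k) ≡ just (suc k)) (idPerm-append k)
        (at-append-last k (proj₁ (idPerm-node k))))))

wonGames : ℕ → ℕ → Strategy → ℕ
wonGames N k σ = length (filterᵇ (λ π → maybeEqᵇ (at π (accepted N k σ π)) N) (Space N k))

wonGames-extSum : ∀ n k σ →
  wonGames (n + k) k σ ≡ extSum n k k (idPerm k) (win (n + k) σ [] (remaining k n))
wonGames-extSum n k σ = trans
  (length-filterᵇ (λ π → maybeEqᵇ (at π (accepted (n + k) k σ π)) (n + k)) (Space (n + k) k))
  (trans (∑-Space n k (win (n + k) σ [] (candidates (n + k) k)))
    (cong (λ cs → extSum n k k (idPerm k) (win (n + k) σ [] cs)) (candidates-remaining n k)))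

wonGames-≤ : ∀ n k σ → wonGames (n + k) k σ ≤ value n k
wonGames-≤ n k σ = ≤-trans (≤-reflexive (wonGames-extSum n k σ))
  (extSum-win≤value (n + k) σ n refl (idPerm-node k))

wonGames-optimal : ∀ n k → wonGames (n + k) k (optimal (n + k)) ≡ value n k
wonGames-optimal n k = trans (wonGames-extSum n k (optimal (n + k)))
  (extSum-optimal (n + k) n refl (idPerm-node k))

-- Probabilities

/-mono-≤ : ∀ {a b} m → a ≤ b → (ℤ.+ a / suc m) ℚ.≤ (ℤ.+ b / suc m)
/-mono-≤ {a} {b} m a≤b = ℚ.toℚᵘ-cancel-≤ (begin
  ℚ.toℚᵘ (ℤ.+ a / suc m)   ≃⟨ ℚ.toℚᵘ-fromℚᵘ (mkℚᵘ (ℤ.+ a) m) ⟩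
  mkℚᵘ (ℤ.+ a) m           ≤⟨ *≤* (ℤ.*-monoʳ-≤-nonNeg (ℤ.+ suc m) (+≤+ a≤b)) ⟩
  mkℚᵘ (ℤ.+ b) m           ≃⟨ ℚ.toℚᵘ-fromℚᵘ (mkℚᵘ (ℤ.+ b) m) ⟨
  ℚ.toℚᵘ (ℤ.+ b / suc m)   ∎)
  where open ℚᵘ.≤-Reasoning

/-mono-< : ∀ {a b} m → a < b → (ℤ.+ a / suc m) ℚ.< (ℤ.+ b / suc m)
/-mono-< {a} {b} m a<b = ℚ.toℚᵘ-cancel-< (begin-strict
  ℚ.toℚᵘ (ℤ.+ a / suc m)   ≃⟨ ℚ.toℚᵘ-fromℚᵘ (mkℚᵘ (ℤ.+ a) m) ⟩
  mkℚᵘ (ℤ.+ a) m           <⟨ *<* (ℤ.*-monoʳ-<-pos (ℤ.+ suc m) (+<+ a<b)) ⟩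
  mkℚᵘ (ℤ.+ b) m           ≃⟨ ℚ.toℚᵘ-fromℚᵘ (mkℚᵘ (ℤ.+ b) m) ⟨
  ℚ.toℚᵘ (ℤ.+ b / suc m)   ∎)
  where open ℚᵘ.≤-Reasoning

module _ (E F : List ℕ → Bool) where

  prob-mono-≤ : ∀ xs → length (filterᵇ E xs) ≤ length (filterᵇ F xs) → prob E xs ℚ.≤ prob F xs
  prob-mono-≤ []       _ = ℚ.≤-refl
  prob-mono-≤ (x ∷ xs)   = /-mono-≤ (length xs)

  prob-mono-< : ∀ xs → length (filterᵇ E xs) < length (filterᵇ F xs) → prob E xs ℚ.< prob F xs
  prob-mono-< (x ∷ xs) = /-mono-< (length xs)

prob-cancel-< : ∀ E F xs → prob E xs ℚ.< prob F xs → length (filterᵇ E xs) < length (filterᵇ F xs)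
prob-cancel-< E F xs pE<pF = ≰⇒> λ F≤E →
  ℚ.<-irrefl refl (ℚ.<-≤-trans pE<pF (prob-mono-≤ F E xs F≤E))

-- Both probabilities have the size of the same space as denominator, so the comparison is one of
-- counts.
Optimal⇔value<wins : ∀ n k → Optimal (n + suc k) (suc k) ⇔ value n (suc k) < wins n (suc k)
Optimal⇔value<wins n k = mk⇔ to from
  where
  N : ℕ
  N = n + suc k
  wonBy : Strategy → List ℕ → Bool
  wonBy σ π = maybeEqᵇ (at π (accepted N (suc k) σ π)) N
  wonNow : List ℕ → Bool
  wonNow π = maybeEqᵇ (at π (suc k)) N
  winProb-≤ : ∀ σ → winProb N (suc k) σ ℚ.≤ winProb N (suc k) (optimal N)
  winProb-≤ σ = prob-mono-≤ (wonBy σ) (wonBy (optimal N)) (Space N (suc k))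
    (≤-trans (wonGames-≤ n (suc k) σ) (≤-reflexive (sym (wonGames-optimal n (suc k)))))
  to : Optimal N (suc k) → value n (suc k) < wins n (suc k)
  -- The maximal probability `q` bounds that of `optimal`, whose count is known exactly.
  to (q , (_ , q-max) , q<S) = subst₂ _<_ (wonGames-optimal n (suc k)) (count-S n k)
    (prob-cancel-< (wonBy (optimal N)) wonNow (Space N (suc k)) (ℚ.≤-<-trans (q-max (optimal N)) q<S))
  from : value n (suc k) < wins n (suc k) → Optimal N (suc k)
  from v<w = winProb N (suc k) (optimal N) , ((optimal N , refl) , winProb-≤) ,
    prob-mono-< (wonBy (optimal N)) wonNow (Space N (suc k))
      (subst₂ _<_ (sym (wonGames-optimal n (suc k))) (sym (count-S n k)) v<w)

theorem4p5 : (N k : ℕ) → 1 ≤ k → k < N →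
    (Optimal N k → Optimal (suc N) (suc k)) × (¬ Optimal N k → ¬ Optimal (suc N) k)
theorem4p5 N (suc k) _ k<N = subst Claim (m∸n+n≡m (<⇒≤ k<N)) (grow , shrink)
  where
  open Equivalence
  n : ℕ
  n = N ∸ suc k
  Claim : ℕ → Set
  Claim N = (Optimal N (suc k) → Optimal (suc N) (2 + k)) × (¬ Optimal N (suc k) → ¬ Optimal (suc N) (suc k))
  -- Passing to (N + 1, k + 1) keeps the number n of candidates to come; passing to (N + 1, k)
  -- raises it by one.
  grow : Optimal (n + suc k) (suc k) → Optimal (suc (n + suc k)) (2 + k)
  grow o = subst (λ M → Optimal M (2 + k)) (+-suc n (suc k))
    (Optimal⇔value<wins n (suc k) .from (value<wins-suc n k (Optimal⇔value<wins n k .to o)))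
  shrink : ¬ Optimal (n + suc k) (suc k) → ¬ Optimal (suc (n + suc k)) (suc k)
  shrink ¬o o = ¬o (Optimal⇔value<wins n k .from
    (value<wins-pred n k (Optimal⇔value<wins (suc n) k .to o)))
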